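{- Let $n>75$ be an even integer. (1) Let $S$ be a Steiner quadruple system $S(3,4,2n+2)$ and let $B$ be a $3$-wise bipartite balanced design whose two parts each have $n$ points. Then there exists a Steiner quadruple system $S'$ of type $S(3,4,8n+2)$ on a point set $\Omega$ that contains a copy of $S$ and a copy of $B$, i.e. there are injections of the point sets of $S$ and of $B$ into $\Omega$ mapping every block of $S$, respectively of $B$, onto a block of $S'$. (2) Let $S$ be a design $S(3,\{4,6\},2n+2)$ and let $B$ be a $3$-wise bipartite balanced design whose two parts each have $n$ points. Then there exists a design $S'$ of type $S(3,\{4,6\},8n+2)$ on a point set $\Omega$ that contains a copy of $S$ and a copy of $B$ in the same sense.
   Context: A Steiner system $S(3,4,v)$ (Steiner quadruple system) is a set of $4$-element subsets (blocks) of a $v$-element set such that every $3$-element subset lies in exactly one block. A design $S(3,\{4,6\},v)$ is a set of blocks of size $4$ or $6$ of a $v$-element set such that every $3$-element subset lies in exactly one block. A $3$-wise bipartite balanced design on a finite set $X$ is a triple $(X,\{g_1,g_2\},B)$ where $\{g_1,g_2\}$ is a partition of $X$ with $|g_1|=|g_2|$ and $B$ is a set of $4$-element blocks with $|b\cap g_1|=|b\cap g_2|=2$ for all $b\in B$, such that every $3$-element subset of $X$ meeting both $g_1$ and $g_2$ lies in exactly one block. -}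

module Defs where

open import Data.Nat using (ℕ; _+_; _*_)
open import Data.Fin using (Fin)
open import Data.Bool using (Bool; true; false)
open import Data.Sum using (_⊎_; inj₁; inj₂)
open import Data.Product using (_×_; Σ; ∃-syntax)
open import Data.List using (List; length; lookup; map; filterᵇ)
open import Data.List.Membership.Propositional using (_∈_)
open import Data.List.Relation.Unary.All using (All)
open import Data.List.Relation.Unary.Any using (Any)
open import Data.List.Relation.Unary.Unique.Propositional using (Unique)
open import Relation.Binary.PropositionalEquality using (_≡_; _≢_)
open import Function.Definitions using (Injective)

-- A block is a finite list of points (required to be duplicate-free);
-- a design is a list of blocks.
Block : Set → Set
Block A = List A

Contains : {A : Set} → Block A → A → A → A → Set
Contains b x y z = (x ∈ b) × (y ∈ b) × (z ∈ b)

ExactlyOnce : {A : Set} → List (Block A) → A → A → A → Set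
ExactlyOnce D x y z =
  ∃[ i ] (Contains (lookup D i) x y z
          × (∀ j → Contains (lookup D j) x y z → j ≡ i))

Distinct3 : {A : Set} → A → A → A → Set
Distinct3 x y z = (x ≢ y) × (x ≢ z) × (y ≢ z)

SQS : (v : ℕ) → List (Block (Fin v)) → Set
SQS v D =
  All (λ b → (length b ≡ 4) × Unique b) D
  × (∀ x y z → Distinct3 x y z → ExactlyOnce D x y z)

S346 : (v : ℕ) → List (Block (Fin v)) → Set
S346 v D =
  All (λ b → ((length b ≡ 4) ⊎ (length b ≡ 6)) × Unique b) D
  × (∀ x y z → Distinct3 x y z → ExactlyOnce D x y z)

-- Bipartite point set with two parts of n points each:
-- X = Fin n ⊎ Fin n, g₁ = image of inj₁, g₂ = image of inj₂.
isG₁ : {n : ℕ} → Fin n ⊎ Fin n → Bool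
isG₁ (inj₁ _) = true
isG₁ (inj₂ _) = false

isG₂ : {n : ℕ} → Fin n ⊎ Fin n → Bool
isG₂ (inj₁ _) = false
isG₂ (inj₂ _) = true

MeetsBoth : {n : ℕ} → Fin n ⊎ Fin n → Fin n ⊎ Fin n → Fin n ⊎ Fin n → Set
MeetsBoth x y z =
  (∃[ p ] ((p ≡ x ⊎ p ≡ y ⊎ p ≡ z) × isG₁ p ≡ true))
  × (∃[ q ] ((q ≡ x ⊎ q ≡ y ⊎ q ≡ z) × isG₂ q ≡ true))

BBD : (n : ℕ) → List (Block (Fin n ⊎ Fin n)) → Set
BBD n D =
  All (λ b → (length b ≡ 4) × Unique b
             × (length (filterᵇ isG₁ b) ≡ 2)
             × (length (filterᵇ isG₂ b) ≡ 2)) D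
  × (∀ x y z → Distinct3 x y z → MeetsBoth x y z → ExactlyOnce D x y z)

SameElems : {A : Set} → Block A → Block A → Set
SameElems b c = ∀ x → ((x ∈ b) → (x ∈ c)) × ((x ∈ c) → (x ∈ b))

Embeds : {A : Set} {m : ℕ} → List (Block A) → List (Block (Fin m)) → Set
Embeds {A} {m} D D' =
  Σ (A → Fin m) λ f →
    Injective _≡_ _≡_ f × All (λ b → Any (λ b' → SameElems (map f b) b') D') D

{-# OPTIONS --safe #-}

-- A variant of Hanani's construction v ↦ 4v − 6 with v = 2n + 2.  Take two stem points and
-- four groups of 2n points, arranged in two pairs, each group a copy of Fin n × Bool.  Every
-- group together with the stem carries a copy of S.  Two groups of the same pair are joined by
-- four copies of B, one for each choice of a half in either group, and by blocks through both
-- halves of both groups.  Every other block joins points y, z of the two groups of a pair to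
-- two points among the stem and a group of the other pair.  For fixed y and z these two points
-- form an edge of a near-one-factorization coming from addition modulo 2n: the sums equal to
-- an even number 2s give a matching that misses exactly s and s + n, and these two points are
-- matched with the stem points; the odd sums give perfect matchings.

module Submission where

open import Defs
open import Data.Bool using (Bool; true; false; not; _∧_; _xor_; T?)
open import Data.Bool.Properties using (not-¬; ¬-not; not-involutive; xor-comm; xor-identityʳ; xor-same)
  renaming (_≟_ to _≟ᵇ_)
open import Data.Empty using (⊥; ⊥-elim)
open import Data.Fin using (Fin; zero; suc; toℕ; cast; combine)
open import Data.Fin.Properties as Fin
  using (toℕ-injective; toℕ-fromℕ<; toℕ<n; toℕ-cast; toℕ-combine; *↔×; +↔⊎; 2↔Bool)
open import Data.Nat as ℕ using (ℕ; zero; suc; _+_; _*_; _∸_; _<_; NonZero)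
open import Data.Nat.DivMod
import Data.Nat.Properties as ℕ
open import Data.Nat.Tactic.RingSolver using (solve-∀)
open import Data.Nat.Divisibility using (_∣_)
open import Data.List
  using (List; []; _∷_; _++_; length; lookup; map; filter; deduplicate; cartesianProduct; allFin)
open import Data.List.Membership.Propositional using (_∈_; _∉_)
open import Data.List.Membership.Propositional.Properties
open import Data.List.Properties using (length-map; map-∘)
open import Data.List.Relation.Unary.All as All using (All; []; _∷_)
import Data.List.Relation.Unary.All.Properties as All
open import Data.List.Relation.Unary.AllPairs using (AllPairs; []; _∷_)
import Data.List.Relation.Unary.AllPairs.Properties as AllPairs
open import Data.List.Relation.Unary.Any as Any using (Any; here; there)
import Data.List.Relation.Unary.Any.Properties as Any
open import Data.List.Relation.Unary.Unique.Propositional using (Unique)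
import Data.List.Relation.Unary.Unique.Propositional.Properties as Unique
open import Data.Product using (_×_; _,_; proj₁; proj₂; ∃-syntax)
open import Data.Product.Properties using (≡-dec)
open import Data.Sum as Sum using (_⊎_; inj₁; inj₂)
open import Data.Sum.Properties using (inj₁-injective; inj₂-injective)
open import Function using (_∘_; _∋_; id; _↔_; Inverse; Injection; mk↔ₛ′)
open import Function.Properties.Inverse using (↔⇒↣)
open import Function.Definitions using (Injective)
open import Function.Construct.Identity using (↔-id)
open import Function.Construct.Symmetry using (↔-sym)
open import Function.Construct.Composition using (_↔-∘_)
open import Function.Related.TypeIsomorphisms using (×-comm)
open import Data.Product.Function.NonDependent.Propositional using (_×-↔_)
open import Data.Sum.Function.Propositional using (_⊎-↔_)
open import Relation.Binary.PropositionalEquality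
open import Relation.Nullary using (Dec; yes; no; ¬_; ¬?; contradiction)
open import Relation.Nullary.Decidable using (True; toWitness; map′; _×-dec_; _→-dec_)

private
  variable
    A C : Set

-- Blocks up to equality of their point sets.

same-reflexive : {b c : Block A} → b ≡ c → SameElems b c
same-reflexive refl x = id , id

same-sym : {b c : Block A} → SameElems b c → SameElems c b
same-sym s x = proj₂ (s x) , proj₁ (s x)

same-trans : {b c d : Block A} → SameElems b c → SameElems c d → SameElems b d
same-trans s t x = proj₁ (t x) ∘ proj₁ (s x) , proj₂ (s x) ∘ proj₂ (t x)

same-map : (f : A → C) {b c : Block A} → SameElems b c → SameElems (map f b) (map f c)
same-map f s y = push (λ x → proj₁ (s x)) , push (λ x → proj₂ (s x))
  where
  push : ∀ {b c y} → (∀ x → x ∈ b → x ∈ c) → y ∈ map f b → y ∈ map f c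
  push s y∈ with x , x∈ , refl ← ∈-map⁻ f y∈ = ∈-map⁺ f (s x x∈)

same-swap : {w x y z : A} → SameElems (w ∷ x ∷ y ∷ z ∷ []) (w ∷ x ∷ z ∷ y ∷ [])
same-swap v = sw , sw
  where
  sw : ∀ {w x y z v : A} → v ∈ (w ∷ x ∷ y ∷ z ∷ []) → v ∈ (w ∷ x ∷ z ∷ y ∷ [])
  sw (here e)                         = here e
  sw (there (here e))                 = there (here e)
  sw (there (there (here e)))         = there (there (there (here e)))
  sw (there (there (there (here e)))) = there (there (here e))

contains-map : (f : A → C) {b : Block A} {x y z : A} →
               Contains b x y z → Contains (map f b) (f x) (f y) (f z)
contains-map f (x∈ , y∈ , z∈) = ∈-map⁺ f x∈ , ∈-map⁺ f y∈ , ∈-map⁺ f z∈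

contains-same : {b c : Block A} {x y z : A} → SameElems b c → Contains b x y z → Contains c x y z
contains-same s (x∈ , y∈ , z∈) = proj₁ (s _) x∈ , proj₁ (s _) y∈ , proj₁ (s _) z∈

∈-map-injective⁻ : {f : A → C} → Injective _≡_ _≡_ f → ∀ {x b} → f x ∈ map f b → x ∈ b
∈-map-injective⁻ {f = f} inj fx∈ with y , y∈ , eq ← ∈-map⁻ f fx∈ = subst (_∈ _) (sym (inj eq)) y∈

-- As opposed to ExactlyOnce, blocks with the same points are identified, so that
-- a list may repeat a block.
Once : (Block A → Set) → A → A → A → Set
Once 𝓑 x y z =
  ∃[ b ] (𝓑 b × Contains b x y z × (∀ {c} → 𝓑 c → Contains c x y z → SameElems b c))

once-swap₁₂ : {𝓑 : Block A → Set} {x y z : A} → Once 𝓑 x y z → Once 𝓑 y x z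
once-swap₁₂ (b , b∈ , (x∈ , y∈ , z∈) , uniq) =
  b , b∈ , (y∈ , x∈ , z∈) , λ c∈ (p , q , r) → uniq c∈ (q , p , r)

once-swap₂₃ : {𝓑 : Block A → Set} {x y z : A} → Once 𝓑 x y z → Once 𝓑 x z y
once-swap₂₃ (b , b∈ , (x∈ , y∈ , z∈) , uniq) =
  b , b∈ , (x∈ , z∈ , y∈) , λ c∈ (p , q , r) → uniq c∈ (p , r , q)

exactlyOnce⇒once : {D : List (Block A)} {x y z : A} → ExactlyOnce D x y z → Once (_∈ D) x y z
exactlyOnce⇒once {D = D} {x} {y} {z} (i , xyz , uniq) = lookup D i , ∈-lookup i , xyz , same
  where
  same : ∀ {c} → c ∈ D → Contains c x y z → SameElems (lookup D i) c
  same c∈ xyz′ = same-reflexive (trans (cong (lookup D) (sym j≡i)) (sym (Any.lookup-index c∈)))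
    where
    j≡i : Any.index c∈ ≡ i
    j≡i = uniq _ (subst (λ b → Contains b x y z) (Any.lookup-index c∈) xyz′)

↔-injective : (f : A ↔ C) → Injective _≡_ _≡_ (Inverse.to f)
↔-injective f = Injection.injective (↔⇒↣ f)

once-image : {D : List (Block A)} (f : A ↔ C) {x y z : C} →
             let open Inverse f in
             Once (_∈ D) (from x) (from y) (from z) → Once (_∈ map (map to) D) x y z
once-image {D = D} f {x} {y} {z} (b , b∈ , (x∈ , y∈ , z∈) , uniq) =
  map to b , ∈-map⁺ (map to) b∈ , (push x∈ , push y∈ , push z∈) , same
  where
  open Inverse f
  push : ∀ {x b} → from x ∈ b → x ∈ map to b
  push x∈ = subst (_∈ _) (strictlyInverseˡ _) (∈-map⁺ to x∈)
  pull : ∀ {x b} → x ∈ map to b → from x ∈ b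
  pull x∈ with _ , y∈ , refl ← ∈-map⁻ to x∈ = subst (_∈ _) (sym (strictlyInverseʳ _)) y∈
  same : ∀ {c} → c ∈ map (map to) D → Contains c x y z → SameElems (map to b) c
  same c∈ (x∈ , y∈ , z∈) with c₀ , c₀∈ , refl ← ∈-map⁻ (map to) c∈ =
    same-map to (uniq c₀∈ (pull x∈ , pull y∈ , pull z∈))

-- Removal of repeated blocks.

module _ {m : ℕ} where
  open import Data.List.Membership.DecPropositional (Fin._≟_ {m}) using (_∈?_)

  sameElems? : (b c : Block (Fin m)) → Dec (SameElems b c)
  sameElems? b c =
    Fin.all? λ x → (x ∈? b →-dec x ∈? c) ×-dec (x ∈? c →-dec x ∈? b)

  deduplicate-distinct : (D : List (Block (Fin m))) →
                         AllPairs (λ b c → ¬ SameElems b c) (deduplicate sameElems? D)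
  deduplicate-distinct []      = []
  deduplicate-distinct (b ∷ D) =
    All.all-filter (¬? ∘ sameElems? b) (deduplicate sameElems? D)
    ∷ AllPairs.filter⁺ (¬? ∘ sameElems? b) (deduplicate-distinct D)

  distinct-index : {D : List (Block (Fin m))} → AllPairs (λ b c → ¬ SameElems b c) D →
                   ∀ i j → SameElems (lookup D i) (lookup D j) → i ≡ j
  distinct-index (_ ∷ _)   zero    zero    _ = refl
  distinct-index (b∉ ∷ _)  zero    (suc j) s = contradiction s (All.lookup b∉ (∈-lookup j))
  distinct-index (b∉ ∷ _)  (suc i) zero    s =
    contradiction (same-sym s) (All.lookup b∉ (∈-lookup i))
  distinct-index (_ ∷ ds)  (suc i) (suc j) s = cong suc (distinct-index ds i j s)

  deduplicate-keeps : (D : List (Block (Fin m))) {b : Block (Fin m)} → b ∈ D →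
                      Any (SameElems b) (deduplicate sameElems? D)
  deduplicate-keeps D b∈ =
    Any.deduplicate⁺ sameElems? (λ s t → same-trans t (same-sym s)) (Any.map same-reflexive b∈)

  -- Any two blocks through the triple have the same points, and after deduplication blocks at
  -- different positions do not, so only one position remains. The surviving representative may list
  -- its points in another order than `b`, hence the passage through `kept`.
  once⇒exactlyOnce : (D : List (Block (Fin m))) {x y z : Fin m} →
                     Once (_∈ D) x y z → ExactlyOnce (deduplicate sameElems? D) x y z
  once⇒exactlyOnce D {x} {y} {z} (b , b∈ , xyz , uniq) =
    Any.index kept , contains-same (Any.lookup-result kept) xyz , only
    where
    kept : Any (SameElems b) (deduplicate sameElems? D)
    kept = deduplicate-keeps D b∈
    only : ∀ j → Contains (lookup (deduplicate sameElems? D) j) x y z → j ≡ Any.index kept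
    only j xyzⱼ = distinct-index (deduplicate-distinct D) j _
      (same-trans (same-sym (uniq (∈-deduplicate⁻ sameElems? D (∈-lookup j)) xyzⱼ))
                  (Any.lookup-result kept))

-- Commutative quasigroups and addition modulo `m`.

record CommutativeQuasigroup (A : Set) : Set where
  infixl 7 _∙_ _∖_
  field
    _∙_         : A → A → A
    _∖_         : A → A → A
    comm        : ∀ x y → x ∙ y ≡ y ∙ x
    leftDivides : ∀ x y → x ∙ (x ∖ y) ≡ y
    cancelˡ     : ∀ x {y z} → x ∙ y ≡ x ∙ z → y ≡ z

  cancelʳ : ∀ {x y} z → x ∙ z ≡ y ∙ z → x ≡ y
  cancelʳ z eq = cancelˡ z (trans (comm z _) (trans eq (comm _ z)))

product : CommutativeQuasigroup A → CommutativeQuasigroup C → CommutativeQuasigroup (A × C)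
product Q R = record
  { _∙_         = λ (x , x′) (y , y′) → (x Q.∙ y) , (x′ R.∙ y′)
  ; _∖_         = λ (x , x′) (y , y′) → (x Q.∖ y) , (x′ R.∖ y′)
  ; comm        = λ _ _ → cong₂ _,_ (Q.comm _ _) (R.comm _ _)
  ; leftDivides = λ _ _ → cong₂ _,_ (Q.leftDivides _ _) (R.leftDivides _ _)
  ; cancelˡ     = λ _ eq → cong₂ _,_ (Q.cancelˡ _ (cong proj₁ eq)) (R.cancelˡ _ (cong proj₂ eq))
  }
  where
  module Q = CommutativeQuasigroup Q
  module R = CommutativeQuasigroup R

xor-self-inverse : ∀ p q → p xor (p xor q) ≡ q
xor-self-inverse false q = refl
xor-self-inverse true  q = not-involutive q

xor-quasigroup : CommutativeQuasigroup Bool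
xor-quasigroup = record
  { _∙_         = _xor_
  ; _∖_         = _xor_
  ; comm        = xor-comm
  ; leftDivides = xor-self-inverse
  ; cancelˡ     = λ p eq →
      trans (sym (xor-self-inverse p _)) (trans (cong (p xor_) eq) (xor-self-inverse p _))
  }

module _ (m : ℕ) ⦃ _ : NonZero m ⦄ where
  open ≡-Reasoning

  toℕ-mod : ∀ k → toℕ (k mod m) ≡ k % m
  toℕ-mod k = toℕ-fromℕ< (m%n<n k m)

  private
    reduceʳ : ∀ a b → (a + b % m) % m ≡ (a + b) % m
    reduceʳ a b = begin
      (a + b % m) % m           ≡⟨ %-distribˡ-+ a (b % m) m ⟩
      (a % m + b % m % m) % m   ≡⟨ cong (λ c → (a % m + c) % m) (m%n%n≡m%n b m) ⟩
      (a % m + b % m) % m       ≡⟨ %-distribˡ-+ a b m ⟨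
      (a + b) % m               ∎

    residue : (i : Fin m) → toℕ i % m ≡ toℕ i
    residue i = m<n⇒m%n≡m (toℕ<n i)

    -- A natural number congruent to the difference modulo `m`. Taking `toℕ j` away from `m` first
    -- avoids truncated subtraction, since `toℕ j` is below `m`.
    _⊖_ : Fin m → Fin m → ℕ
    i ⊖ j = (m ∸ toℕ j) + toℕ i

    ⊖-+ : ∀ i j → (toℕ j + (i ⊖ j)) % m ≡ toℕ i
    ⊖-+ i j = begin
      (toℕ j + ((m ∸ toℕ j) + toℕ i)) % m ≡⟨ cong (_% m) (ℕ.+-assoc (toℕ j) _ _) ⟨
      (toℕ j + (m ∸ toℕ j) + toℕ i) % m   ≡⟨ cong (λ c → (c + toℕ i) % m) (ℕ.m+[n∸m]≡n (ℕ.<⇒≤ (toℕ<n j))) ⟩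
      (m + toℕ i) % m                     ≡⟨ cong (_% m) (ℕ.+-comm m (toℕ i)) ⟩
      (toℕ i + m) % m                     ≡⟨ [m+n]%n≡m%n (toℕ i) m ⟩
      toℕ i % m                           ≡⟨ residue i ⟩
      toℕ i                               ∎

  mod-+ : CommutativeQuasigroup (Fin m)
  mod-+ = record
    { _∙_         = _⊕_
    ; _∖_         = λ j i → (i ⊖ j) mod m
    ; comm        = λ i j → cong (_mod m) (ℕ.+-comm (toℕ i) (toℕ j))
    ; leftDivides = λ j i → toℕ-injective (begin
        toℕ (j ⊕ ((i ⊖ j) mod m))             ≡⟨ toℕ-mod _ ⟩
        (toℕ j + toℕ ((i ⊖ j) mod m)) % m     ≡⟨ cong (λ c → (toℕ j + c) % m) (toℕ-mod (i ⊖ j)) ⟩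
        (toℕ j + (i ⊖ j) % m) % m             ≡⟨ reduceʳ (toℕ j) (i ⊖ j) ⟩
        (toℕ j + (i ⊖ j)) % m                 ≡⟨ ⊖-+ i j ⟩
        toℕ i                                 ∎)
    -- Subtracting `j` recovers the second summand from the sum, so equal sums have equal second
    -- summands.
    ; cancelˡ     = λ j {i} {k} eq → toℕ-injective (begin
        toℕ i              ≡⟨ undo j i ⟨
        toℕ ((j ⊕ i) ⊝ j)  ≡⟨ cong (λ c → toℕ (c ⊝ j)) eq ⟩
        toℕ ((j ⊕ k) ⊝ j)  ≡⟨ undo j k ⟩
        toℕ k              ∎)
    }
    where
    _⊕_ _⊝_ : Fin m → Fin m → Fin m
    i ⊕ j = (toℕ i + toℕ j) mod m
    i ⊝ j = (i ⊖ j) mod m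
    undo : ∀ j i → toℕ ((j ⊕ i) ⊝ j) ≡ toℕ i
    undo j i = begin
      toℕ ((j ⊕ i) ⊝ j)                             ≡⟨ toℕ-mod _ ⟩
      ((m ∸ toℕ j) + toℕ (j ⊕ i)) % m               ≡⟨ cong (λ c → ((m ∸ toℕ j) + c) % m) (toℕ-mod _) ⟩
      ((m ∸ toℕ j) + (toℕ j + toℕ i) % m) % m       ≡⟨ reduceʳ (m ∸ toℕ j) (toℕ j + toℕ i) ⟩
      ((m ∸ toℕ j) + (toℕ j + toℕ i)) % m           ≡⟨ cong (_% m) (swap (m ∸ toℕ j) (toℕ j) (toℕ i)) ⟩
      (toℕ j + ((m ∸ toℕ j) + toℕ i)) % m           ≡⟨ ⊖-+ i j ⟩
      toℕ i                                         ∎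
      where
      swap : ∀ a b c → a + (b + c) ≡ b + (a + c)
      swap a b c = trans (sym (ℕ.+-assoc a b c)) (trans (cong (_+ c) (ℕ.+-comm a b)) (ℕ.+-assoc b a c))

-- An isotope of `Q`: arguments and values pass through unrelated bijections. Commutativity survives
-- because both arguments use the same one, `enter`.
transport : CommutativeQuasigroup A → C ↔ A → A ↔ C → CommutativeQuasigroup C
transport Q enter leave = record
  { _∙_         = λ x y → to leave (to enter x ∙ to enter y)
  ; _∖_         = λ x y → from enter (to enter x ∖ from leave y)
  ; comm        = λ x y → cong (to leave) (comm _ _)
  ; leftDivides = λ x y → trans
      (cong (to leave) (trans (cong (to enter x ∙_) (strictlyInverseˡ enter _)) (leftDivides _ _)))
      (strictlyInverseˡ leave y)
  ; cancelˡ     = λ x eq → ↔-injective enter (cancelˡ (to enter x) (↔-injective leave eq))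
  }
  where
  open CommutativeQuasigroup Q
  open Inverse using (to; from; strictlyInverseˡ)

cast↔ : ∀ {k l} → k ≡ l → Fin k ↔ Fin l
cast↔ eq = mk↔ₛ′ (cast eq) (cast (sym eq))
  (Fin.cast-involutive eq (sym eq)) (Fin.cast-involutive (sym eq) eq)

-- The addition of ℤ/2n, written on Fin n × Bool through two different bijections:
-- an argument (a , p) stands for a + p n, while a value (a , p) stands for 2a + p.
module _ (n : ℕ) ⦃ _ : NonZero n ⦄ where
  private instance
    2n≢0 : NonZero (2 * n)
    2n≢0 = ℕ.m*n≢0 2 n

  private
    number : (Fin n × Bool) ↔ Fin (2 * n)
    number = ↔-sym (×-comm _ _ ↔-∘ ((2↔Bool ×-↔ ↔-id _) ↔-∘ *↔×))

    half : Fin (2 * n) ↔ (Fin n × Bool)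
    half = (↔-id _ ×-↔ 2↔Bool) ↔-∘ (*↔× ↔-∘ cast↔ (ℕ.*-comm 2 n))

  halving : CommutativeQuasigroup (Fin n × Bool)
  halving = transport (mod-+ (2 * n)) number half

  -- Doubling `a + p n` gives `2a + p(2n)`, which is `2a` modulo `2n` and is read as the value
  -- `(a , false)`. Thus a value with bit `false` has exactly the two square roots `(a , false)` and
  -- `(a , true)`, and a value with bit `true` has none.
  halving-diagonal : ∀ a p → let open CommutativeQuasigroup halving in (a , p) ∙ (a , p) ≡ (a , false)
  halving-diagonal a p =
    trans (cong (to half) (toℕ-injective same)) (strictlyInverseˡ half (a , false))
    where
    open Inverse
    open ≡-Reasoning
    P = from 2↔Bool p
    N = to number (a , p)
    -- The summand 0 is kept because `toℕ-combine` produces it for the bit `zero`.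
    double : ∀ n x y → (n * x + y) + (n * x + y) ≡ 2 * y + 0 + x * (2 * n)
    double = solve-∀
    2a<2n : 2 * toℕ a + 0 < 2 * n
    2a<2n = subst (_< 2 * n) (sym (ℕ.+-identityʳ _)) (ℕ.*-monoʳ-< 2 (toℕ<n a))
    same : toℕ ((toℕ N + toℕ N) mod (2 * n)) ≡ toℕ (from half (a , false))
    same = begin
      toℕ ((toℕ N + toℕ N) mod (2 * n))             ≡⟨ toℕ-mod (2 * n) (toℕ N + toℕ N) ⟩
      (toℕ N + toℕ N) % (2 * n)                     ≡⟨ cong (λ k → (k + k) % (2 * n)) (toℕ-combine P a) ⟩
      ((n * toℕ P + toℕ a) + (n * toℕ P + toℕ a)) % (2 * n)
                                                    ≡⟨ cong (_% (2 * n)) (double n (toℕ P) (toℕ a)) ⟩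
      (2 * toℕ a + 0 + toℕ P * (2 * n)) % (2 * n)   ≡⟨ [m+kn]%n≡m%n (2 * toℕ a + 0) (toℕ P) (2 * n) ⟩
      (2 * toℕ a + 0) % (2 * n)                     ≡⟨ m<n⇒m%n≡m 2a<2n ⟩
      2 * toℕ a + 0                                 ≡⟨ toℕ-combine {n = 2} a zero ⟨
      toℕ (combine a (zero {n = 1}))                ≡⟨ toℕ-cast _ _ ⟨
      toℕ (from half (a , false))                   ∎

-- Boolean identities, finite enumerations and bipartite designs.

instance
  ≡-bool? : {p q : Bool} → Dec (p ≡ q)
  ≡-bool? = _ ≟ᵇ _

  ∀-bool? : {P : Bool → Set} ⦃ P? : ∀ {p} → Dec (P p) ⦄ → Dec (∀ p → P p)
  ∀-bool? ⦃ P? ⦄ = map′ (λ { (f , t) → λ { false → f ; true → t } }) (λ all → all false , all true)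
                        (P? {false} ×-dec P? {true})

-- Instance search assembles a decision procedure for a quantified Boolean statement, and evaluating
-- it solves the implicit `True` argument. The parity identities below are proved this way.
truth-table : {P : Set} ⦃ P? : Dec P ⦄ {_ : True P?} → P
truth-table {_} {p} = toWitness p

pick : Bool → A → A → A
pick false x y = x
pick true  x y = y

two-elements : {l : List A} → length l ≡ 2 → ∀ {x y z} → x ∈ l → y ∈ l → z ∈ l →
               x ≡ y ⊎ x ≡ z ⊎ y ≡ z
two-elements {l = _ ∷ _ ∷ []} _ (here refl)         (here refl)         _                   = inj₁ refl
two-elements {l = _ ∷ _ ∷ []} _ (here refl)         (there (here refl)) (here refl)         = inj₂ (inj₁ refl)
two-elements {l = _ ∷ _ ∷ []} _ (here refl)         (there (here refl)) (there (here refl)) = inj₂ (inj₂ refl)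
two-elements {l = _ ∷ _ ∷ []} _ (there (here refl)) (here refl)         (here refl)         = inj₂ (inj₂ refl)
two-elements {l = _ ∷ _ ∷ []} _ (there (here refl)) (here refl)         (there (here refl)) = inj₂ (inj₁ refl)
two-elements {l = _ ∷ _ ∷ []} _ (there (here refl)) (there (here refl)) _                   = inj₁ refl

shape-map : {W : ℕ → Set} {f : A → C} → Injective _≡_ _≡_ f → ∀ {b} →
            W (length b) × Unique b → W (length (map f b)) × Unique (map f b)
shape-map {W = W} {f} inj {b} (w , u) = subst W (sym (length-map f b)) w , Unique.map⁺ inj u

record Enumerable (A : Set) : Set where
  field
    elements : List A
    complete : ∀ x → x ∈ elements

open Enumerable ⦃ ... ⦄

-- Opaque, so that the long lists of parameter tuples are never unfolded; outside this block only
-- `complete` is known about them.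
abstract
  instance
    bool-enumerable : Enumerable Bool
    bool-enumerable = record
      { elements = false ∷ true ∷ []
      ; complete = λ { false → here refl ; true → there (here refl) }
      }

    fin-enumerable : ∀ {n} → Enumerable (Fin n)
    fin-enumerable = record { elements = allFin _ ; complete = ∈-allFin }

    ×-enumerable : ⦃ Enumerable A ⦄ → ⦃ Enumerable C ⦄ → Enumerable (A × C)
    ×-enumerable = record
      { elements = cartesianProduct elements elements
      ; complete = λ (x , y) → ∈-cartesianProduct⁺ (complete x) (complete y)
      }

onSide : ∀ {n} → Bool → Fin n → Fin n ⊎ Fin n
onSide false = inj₁
onSide true  = inj₂

module _ {n : ℕ} {B : List (Block (Fin n ⊎ Fin n))} (bbd : BBD n B) where

  bbd-once : ∀ i {a a′} b → a ≢ a′ → Once (_∈ B) (onSide i a) (onSide i a′) (onSide (not i) b)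
  bbd-once false {a} {a′} b a≢a′ = exactlyOnce⇒once (proj₂ bbd _ _ _
    ((λ { refl → a≢a′ refl }) , (λ ()) , (λ ()))
    ((inj₁ a , inj₁ refl , refl) , (inj₂ b , inj₂ (inj₂ refl) , refl)))
  bbd-once true {a} {a′} b a≢a′ = exactlyOnce⇒once (proj₂ bbd _ _ _
    ((λ { refl → a≢a′ refl }) , (λ ()) , (λ ()))
    ((inj₁ b , inj₂ (inj₂ refl) , refl) , (inj₂ a , inj₁ refl , refl)))

  bbd-two : ∀ i {b a a′ a″} → b ∈ B → onSide i a ∈ b → onSide i a′ ∈ b → onSide i a″ ∈ b →
            a ≡ a′ ⊎ a ≡ a″ ⊎ a′ ≡ a″
  bbd-two false b∈ x∈ y∈ z∈ with All.lookup (proj₁ bbd) b∈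
  ... | _ , _ , two , _ = Sum.map inj₁-injective (Sum.map inj₁-injective inj₁-injective)
    (two-elements two (∈-filter⁺ (T? ∘ isG₁) x∈ _) (∈-filter⁺ (T? ∘ isG₁) y∈ _)
                      (∈-filter⁺ (T? ∘ isG₁) z∈ _))
  bbd-two true b∈ x∈ y∈ z∈ with All.lookup (proj₁ bbd) b∈
  ... | _ , _ , _ , two = Sum.map inj₂-injective (Sum.map inj₂-injective inj₂-injective)
    (two-elements two (∈-filter⁺ (T? ∘ isG₂) x∈ _) (∈-filter⁺ (T? ∘ isG₂) y∈ _)
                      (∈-filter⁺ (T? ∘ isG₂) z∈ _))

-- Points and blocks of the new design.

Stemmed : Set → Set
Stemmed G = Bool ⊎ G

Points : Set → Set
Points G = Stemmed (Bool × Bool × G)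

-- ∞ l is a stem point; pt h i x is the point x of group i in the h-th pair of groups.
pattern ∞ l      = inj₁ l
pattern pt h i x = inj₂ (h , i , x)

-- `W` is the predicate of admissible block sizes. Blocks not copied from `S` have size 4, so `W 4`
-- suffices for them and both halves of the theorem are instances.
module Construction
  {n : ℕ}
  (Q : CommutativeQuasigroup (Fin n))
  (H : CommutativeQuasigroup (Fin n × Bool))
  (H-diagonal : ∀ a p → CommutativeQuasigroup._∙_ H (a , p) (a , p) ≡ (a , false))
  (W : ℕ → Set) (W4 : W 4)
  {S : List (Block (Stemmed (Fin n × Bool)))}
  (S-shape : All (λ b → W (length b) × Unique b) S)
  (S-once : ∀ x y z → Distinct3 x y z → Once (_∈ S) x y z)
  {B : List (Block (Fin n ⊎ Fin n))} (bbd : BBD n B)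
  where

  open CommutativeQuasigroup Q using ()
    renaming ( _∙_ to infixl 7 _·_; _∖_ to _╲_; comm to ·-comm; leftDivides to ·-divides
             ; cancelˡ to ·-cancelˡ; cancelʳ to ·-cancelʳ)
  open CommutativeQuasigroup H using ()
    renaming ( _∙_ to infixl 7 _⊙_; _∖_ to _⊘_; comm to ⊙-comm; leftDivides to ⊙-divides
             ; cancelˡ to ⊙-cancelˡ)
  open CommutativeQuasigroup (product Q xor-quasigroup) using ()
    renaming ( _∙_ to infixl 7 _⊞_; _∖_ to _⊟_; comm to ⊞-comm; leftDivides to ⊞-divides
             ; cancelˡ to ⊞-cancelˡ; cancelʳ to ⊞-cancelʳ)

  G = Fin n × Bool
  P = Points G

  _≟ᴳ_ : (x y : G) → Dec (x ≡ y)
  _≟ᴳ_ = ≡-dec Fin._≟_ _≟ᵇ_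

  fillPt : Bool → Bool → Stemmed G → P
  fillPt h i (∞ l)    = ∞ l
  fillPt h i (inj₂ x) = pt h i x

  bipPt : Bool → Bool → Bool → Fin n ⊎ Fin n → P
  bipPt h p q (inj₁ a) = pt h false (a , p)
  bipPt h p q (inj₂ b) = pt h true (b , q)

  mixBlock : Bool → (a a′ b b′ : Fin n) → Block P
  mixBlock h a a′ b b′ =
    pt h false (a , false) ∷ pt h false (a′ , true) ∷ pt h true (b , false) ∷ pt h true (b′ , true) ∷ []

  branch : G → G → Bool
  branch y z = proj₂ (y ⊞ z)

  -- For fixed `y` and `z`, the apexes for the two values of `l` are the two square roots under `⊙`
  -- of `key (branch y z) y z`, the points that the matching misses. The twist by `h` and the bit of
  -- `y` decides which stem point gets which root; it is chosen so that a stem point and two points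
  -- from different pairs lie in exactly one spoke block (see `Based`).
  apex : Bool → Bool → G → G → G
  apex h l y z = proj₁ (y ⊞ z) , (l xor h) xor proj₂ y

  spokeBlock : Bool → Bool → G → G → Block P
  spokeBlock h l y z =
    ∞ l ∷ pt h false y ∷ pt h true z ∷ pt (not h) (branch y z) (apex h l y z) ∷ []

  shift : Bool → G → G
  shift ε (c , p) = c , p xor ε

  -- The shift gives the key the bit `false` for `ε` equal to `branch y z` and `true` for the other
  -- group. So just one of the two groups of the other pair has a matching with two points left over
  -- for the stem.
  key : Bool → G → G → G
  key ε y z = shift ε (y ⊞ z)

  crossBlock : Bool → Bool → (y z u u′ : G) → Block P
  crossBlock h ε y z u u′ =
    pt h false y ∷ pt h true z ∷ pt (not h) ε u ∷ pt (not h) ε u′ ∷ []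

  -- If the diagonal value u ⊙ u is the key of (ε , y , z), then {y , z , u} is
  -- completed by a stem point (spoke); any other u is completed by its partner u′ in
  -- the equation u ⊙ u′ ≡ key ε y z (cross).
  data Blocks : Block P → Set where
    fill  : ∀ h i {b} → b ∈ S → Blocks (map (fillPt h i) b)
    bip   : ∀ h p q {b} → b ∈ B → Blocks (map (bipPt h p q) b)
    mix   : ∀ h a a′ b b′ → a · a′ ≡ b · b′ → Blocks (mixBlock h a a′ b b′)
    spoke : ∀ h l y z → Blocks (spokeBlock h l y z)
    cross : ∀ h ε y z u u′ → u ≢ u′ → u ⊙ u′ ≡ key ε y z → Blocks (crossBlock h ε y z u u′)

  -- Intersections of the blocks with the stem and the groups.

  h≢¬h : ∀ {h} → h ≢ not h
  h≢¬h = not-¬ refl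

  pt≢pt : ∀ {h i j} {x y : G} → pt h i x ≢ (P ∋ pt (not h) j y)
  pt≢pt eq = h≢¬h (cong proj₁ (inj₂-injective eq))

  fillPt-injective : ∀ h i → Injective _≡_ _≡_ (fillPt h i)
  fillPt-injective h i {∞ _}    {∞ _}    refl = refl
  fillPt-injective h i {inj₂ _} {inj₂ _} refl = refl

  bipPt-injective : ∀ h p q → Injective _≡_ _≡_ (bipPt h p q)
  bipPt-injective h p q {inj₁ _} {inj₁ _} refl = refl
  bipPt-injective h p q {inj₂ _} {inj₂ _} refl = refl

  pt∈fill : ∀ {k j x} h i {b} → pt k j x ∈ map (fillPt h i) b → k ≡ h × j ≡ i
  pt∈fill h i x∈ with ∈-map⁻ (fillPt h i) x∈
  ... | inj₂ _ , _ , refl = refl , refl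

  ∞∉bip : ∀ {l} h p q {b} → ∞ l ∉ map (bipPt h p q) b
  ∞∉bip h p q l∈ with ∈-map⁻ (bipPt h p q) l∈
  ... | inj₁ _ , _ , ()
  ... | inj₂ _ , _ , ()

  pt∈bip : ∀ {k j c r} h p q {b} → pt k j (c , r) ∈ map (bipPt h p q) b →
           k ≡ h × r ≡ pick j p q × onSide j c ∈ b
  pt∈bip h p q x∈ with ∈-map⁻ (bipPt h p q) x∈
  ... | inj₁ _ , a∈ , refl = refl , refl , a∈
  ... | inj₂ _ , b∈ , refl = refl , refl , b∈

  ∞∉mix : ∀ {l h a a′ b b′} → ∞ l ∉ mixBlock h a a′ b b′
  ∞∉mix (there (there (there (there ()))))

  pt∈mix : ∀ {k j c r h a a′ b b′} → pt k j (c , r) ∈ mixBlock h a a′ b b′ →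
           k ≡ h × c ≡ pick j (pick r a a′) (pick r b b′)
  pt∈mix (here refl)                         = refl , refl
  pt∈mix (there (here refl))                 = refl , refl
  pt∈mix (there (there (here refl)))         = refl , refl
  pt∈mix (there (there (there (here refl)))) = refl , refl

  ∞∈spoke : ∀ {l h m y z} → ∞ l ∈ spokeBlock h m y z → l ≡ m
  ∞∈spoke (here refl) = refl
  ∞∈spoke (there (there (there (there ()))))

  pt∈spoke : ∀ {k j x h l y z} → pt k j x ∈ spokeBlock h l y z →
             (k ≡ h × x ≡ pick j y z) ⊎ (k ≡ not h × j ≡ branch y z × x ≡ apex h l y z)
  pt∈spoke (there (here refl))                 = inj₁ (refl , refl)
  pt∈spoke (there (there (here refl)))         = inj₁ (refl , refl)
  pt∈spoke (there (there (there (here refl)))) = inj₂ (refl , refl , refl)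

  ∞∉cross : ∀ {l h ε y z u u′} → ∞ l ∉ crossBlock h ε y z u u′
  ∞∉cross (there (there (there (there ()))))

  pt∈cross : ∀ {k j x h ε y z u u′} → pt k j x ∈ crossBlock h ε y z u u′ →
             (k ≡ h × x ≡ pick j y z) ⊎ (k ≡ not h × j ≡ ε × (x ≡ u ⊎ x ≡ u′))
  pt∈cross (here refl)                         = inj₁ (refl , refl)
  pt∈cross (there (here refl))                 = inj₁ (refl , refl)
  pt∈cross (there (there (here refl)))         = inj₂ (refl , refl , inj₁ refl)
  pt∈cross (there (there (there (here refl)))) = inj₂ (refl , refl , inj₂ refl)

  blocks-shape : ∀ {b} → Blocks b → W (length b) × Unique b
  blocks-shape (fill h i b∈) = shape-map {W = W} (fillPt-injective h i) (All.lookup S-shape b∈)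
  blocks-shape (bip h p q b∈) with len , u , _ ← All.lookup (proj₁ bbd) b∈ =
    shape-map {W = W} (bipPt-injective h p q) (subst W (sym len) W4 , u)
  blocks-shape (mix h a a′ b b′ _) = W4 ,
    ((λ ()) ∷ (λ ()) ∷ (λ ()) ∷ []) ∷ ((λ ()) ∷ (λ ()) ∷ []) ∷ ((λ ()) ∷ []) ∷ [] ∷ []
  blocks-shape (spoke h l y z) = W4 ,
    ((λ ()) ∷ (λ ()) ∷ (λ ()) ∷ []) ∷ ((λ ()) ∷ pt≢pt ∷ []) ∷ (pt≢pt ∷ []) ∷ [] ∷ []
  blocks-shape (cross h ε y z u u′ u≢u′ _) = W4 ,
    ((λ ()) ∷ pt≢pt ∷ pt≢pt ∷ []) ∷ (pt≢pt ∷ pt≢pt ∷ []) ∷ ((λ { refl → u≢u′ refl }) ∷ []) ∷ [] ∷ []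

  spoke-injective : ∀ {k j x x′ h l y z} → pt k j x ∈ spokeBlock h l y z →
                    pt k j x′ ∈ spokeBlock h l y z → x ≡ x′
  spoke-injective x∈ x′∈ with pt∈spoke x∈ | pt∈spoke x′∈
  ... | inj₁ (_ , e)      | inj₁ (_ , e′)     = trans e (sym e′)
  ... | inj₂ (_ , _ , e)  | inj₂ (_ , _ , e′) = trans e (sym e′)
  ... | inj₁ (refl , _)   | inj₂ (e , _)      = contradiction e h≢¬h
  ... | inj₂ (e , _)      | inj₁ (refl , _)   = contradiction e h≢¬h

  spoke-base : ∀ {k y z h l y′ z′} → pt k false y ∈ spokeBlock h l y′ z′ →
               pt k true z ∈ spokeBlock h l y′ z′ → k ≡ h × y ≡ y′ × z ≡ z′
  spoke-base y∈ z∈ with pt∈spoke y∈ | pt∈spoke z∈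
  ... | inj₁ (e , ey)     | inj₁ (_ , ez)     = e , ey , ez
  ... | inj₂ (_ , e , _)  | inj₂ (_ , e′ , _) = contradiction (trans e (sym e′)) λ ()
  ... | inj₁ (refl , _)   | inj₂ (e , _)      = contradiction e h≢¬h
  ... | inj₂ (e , _)      | inj₁ (refl , _)   = contradiction e h≢¬h

  cross-base : ∀ {k y z h ε y′ z′ u u′} → pt k false y ∈ crossBlock h ε y′ z′ u u′ →
               pt k true z ∈ crossBlock h ε y′ z′ u u′ → k ≡ h × y ≡ y′ × z ≡ z′
  cross-base y∈ z∈ with pt∈cross y∈ | pt∈cross z∈
  ... | inj₁ (e , ey)     | inj₁ (_ , ez)     = e , ey , ez
  ... | inj₂ (_ , e , _)  | inj₂ (_ , e′ , _) = contradiction (trans e (sym e′)) λ ()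
  ... | inj₁ (refl , _)   | inj₂ (e , _)      = contradiction e h≢¬h
  ... | inj₂ (e , _)      | inj₁ (refl , _)   = contradiction e h≢¬h

  -- The base contributes a single point to either group of pair `h`, so two different points of one
  -- group must be `u` and `u′` in some order.
  cross-pair : ∀ {k j x x′ h ε y z u u′} → x ≢ x′ → pt k j x ∈ crossBlock h ε y z u u′ →
               pt k j x′ ∈ crossBlock h ε y z u u′ →
               k ≡ not h × j ≡ ε × ((x ≡ u × x′ ≡ u′) ⊎ (x ≡ u′ × x′ ≡ u))
  cross-pair x≢x′ x∈ x′∈ with pt∈cross x∈ | pt∈cross x′∈
  ... | inj₁ (_ , e)              | inj₁ (_ , e′)              = contradiction (trans e (sym e′)) x≢x′
  ... | inj₁ (refl , _)           | inj₂ (e , _)               = contradiction e h≢¬h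
  ... | inj₂ (e , _)              | inj₁ (refl , _)            = contradiction e h≢¬h
  ... | inj₂ (_ , _ , inj₁ e)     | inj₂ (_ , _ , inj₁ e′)     = contradiction (trans e (sym e′)) x≢x′
  ... | inj₂ (_ , _ , inj₂ e)     | inj₂ (_ , _ , inj₂ e′)     = contradiction (trans e (sym e′)) x≢x′
  ... | inj₂ (k≡ , j≡ , inj₁ e)   | inj₂ (_ , _ , inj₂ e′)     = k≡ , j≡ , inj₁ (e , e′)
  ... | inj₂ (k≡ , j≡ , inj₂ e)   | inj₂ (_ , _ , inj₁ e′)     = k≡ , j≡ , inj₂ (e , e′)

  -- Triples inside one group together with the stem.

  fill-once : ∀ h i {v v′ v″} → Distinct3 v v′ v″ →
              (∀ {c} → Blocks c → Contains c (fillPt h i v) (fillPt h i v′) (fillPt h i v″) →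
                       ∃[ b ] (b ∈ S × c ≡ map (fillPt h i) b)) →
              Once Blocks (fillPt h i v) (fillPt h i v′) (fillPt h i v″)
  fill-once h i distinct only with S-once _ _ _ distinct
  ... | b , b∈ , con , uniq = _ , fill h i b∈ , contains-map (fillPt h i) con , same
    where
    same : ∀ {c} → Blocks c → Contains c _ _ _ → SameElems (map (fillPt h i) b) c
    same c∈ con′ with only c∈ con′
    -- Both blocks are images of blocks of `S` under the same injective map, so uniqueness in `S`
    -- carries over.
    same c∈ (x∈ , y∈ , z∈) | b′ , b′∈ , refl = same-map (fillPt h i)
      (uniq b′∈ (∈-map-injective⁻ inj x∈ , ∈-map-injective⁻ inj y∈ , ∈-map-injective⁻ inj z∈))
      where
      inj : Injective _≡_ _≡_ (fillPt h i)
      inj = fillPt-injective h i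

  once-∞∞ : ∀ {l l′} h i x → l ≢ l′ → Once Blocks (∞ l) (∞ l′) (pt h i x)
  once-∞∞ {l} {l′} h i x l≢l′ =
    fill-once h i {∞ l} {∞ l′} {inj₂ x} ((l≢l′ ∘ inj₁-injective) , (λ ()) , (λ ())) only
    where
    only : ∀ {c} → Blocks c → Contains c (∞ l) (∞ l′) (pt h i x) →
           ∃[ b ] (b ∈ S × c ≡ map (fillPt h i) b)
    only (fill h′ i′ b∈) (_ , _ , x∈) with refl , refl ← pt∈fill h′ i′ x∈ = _ , b∈ , refl
    only (bip h′ p q _)  (l∈ , _)      = contradiction l∈ (∞∉bip h′ p q)
    only (mix _ _ _ _ _ _) (l∈ , _)    = contradiction l∈ ∞∉mix
    only (spoke _ _ _ _) (l∈ , l′∈ , _) = contradiction (trans (∞∈spoke l∈) (sym (∞∈spoke l′∈))) l≢l′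
    only (cross _ _ _ _ _ _ _ _) (l∈ , _) = contradiction l∈ ∞∉cross

  once-∞-within : ∀ l h i {x x′} → x ≢ x′ → Once Blocks (∞ l) (pt h i x) (pt h i x′)
  once-∞-within l h i {x} {x′} x≢x′ =
    fill-once h i {∞ l} {inj₂ x} {inj₂ x′} ((λ ()) , (λ ()) , (x≢x′ ∘ inj₂-injective)) only
    where
    only : ∀ {c} → Blocks c → Contains c (∞ l) (pt h i x) (pt h i x′) →
           ∃[ b ] (b ∈ S × c ≡ map (fillPt h i) b)
    only (fill h′ i′ b∈) (_ , _ , x∈) with refl , refl ← pt∈fill h′ i′ x∈ = _ , b∈ , refl
    only (bip h′ p q _)  (l∈ , _)      = contradiction l∈ (∞∉bip h′ p q)
    only (mix _ _ _ _ _ _) (l∈ , _)    = contradiction l∈ ∞∉mix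
    only (spoke _ _ _ _) (_ , x∈ , x′∈) = contradiction (spoke-injective x∈ x′∈) x≢x′
    only (cross _ _ _ _ _ _ _ _) (l∈ , _) = contradiction l∈ ∞∉cross

  -- Only a `fill` block can meet a group in three points: a `bip` block has two points on each
  -- side, a `mix` block one in each half, a `spoke` block at most one and a `cross` block at most
  -- two.
  once-within : ∀ h i {x x′ x″} → Distinct3 x x′ x″ → Once Blocks (pt h i x) (pt h i x′) (pt h i x″)
  once-within h i {x} {x′} {x″} (x≢x′ , x≢x″ , x′≢x″) =
    fill-once h i {inj₂ x} {inj₂ x′} {inj₂ x″}
      ((x≢x′ ∘ inj₂-injective) , (x≢x″ ∘ inj₂-injective) , (x′≢x″ ∘ inj₂-injective)) only
    where
    two-of-three : x ≡ x′ ⊎ x ≡ x″ ⊎ x′ ≡ x″ → ⊥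
    two-of-three (inj₁ e)        = x≢x′ e
    two-of-three (inj₂ (inj₁ e)) = x≢x″ e
    two-of-three (inj₂ (inj₂ e)) = x′≢x″ e
    only : ∀ {c} → Blocks c → Contains c (pt h i x) (pt h i x′) (pt h i x″) →
           ∃[ b ] (b ∈ S × c ≡ map (fillPt h i) b)
    only (fill h′ i′ b∈) (_ , _ , x∈) with refl , refl ← pt∈fill h′ i′ x∈ = _ , b∈ , refl
    only (bip h′ p q b∈) (x∈ , y∈ , z∈)
      with _ , refl , a∈ ← pt∈bip h′ p q x∈ | _ , refl , a′∈ ← pt∈bip h′ p q y∈
         | _ , refl , a″∈ ← pt∈bip h′ p q z∈ =
      ⊥-elim (two-of-three (Sum.map (cong (_, _)) (Sum.map (cong (_, _)) (cong (_, _)))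
                                    (bbd-two bbd i b∈ a∈ a′∈ a″∈)))
    only (mix h′ a a′ b b′ _) (x∈ , y∈ , z∈) = ⊥-elim (two-of-three (pigeonhole _ _ _
        (proj₂ (pt∈mix x∈)) (proj₂ (pt∈mix y∈)) (proj₂ (pt∈mix z∈))))
      where
      f : Bool → Fin n
      f r = pick i (pick r a a′) (pick r b b′)
      pigeonhole : ∀ (x y z : G) →
                   proj₁ x ≡ f (proj₂ x) → proj₁ y ≡ f (proj₂ y) → proj₁ z ≡ f (proj₂ z) →
                   x ≡ y ⊎ x ≡ z ⊎ y ≡ z
      pigeonhole (_ , false) (_ , false) _           refl refl _    = inj₁ refl
      pigeonhole (_ , true)  (_ , true)  _           refl refl _    = inj₁ refl
      pigeonhole (_ , false) (_ , true)  (_ , false) refl _    refl = inj₂ (inj₁ refl)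
      pigeonhole (_ , true)  (_ , false) (_ , true)  refl _    refl = inj₂ (inj₁ refl)
      pigeonhole (_ , false) (_ , true)  (_ , true)  _    refl refl = inj₂ (inj₂ refl)
      pigeonhole (_ , true)  (_ , false) (_ , false) _    refl refl = inj₂ (inj₂ refl)
    only (spoke _ _ _ _) (x∈ , x′∈ , _) = contradiction (spoke-injective x∈ x′∈) x≢x′
    only (cross _ _ _ _ _ _ _ _) (x∈ , x′∈ , x″∈)
      with cross-pair x≢x′ x∈ x′∈ | cross-pair x≢x″ x∈ x″∈
    ... | _ , _ , inj₁ (_ , e) | _ , _ , inj₁ (_ , e′) = contradiction (trans e (sym e′)) x′≢x″
    ... | _ , _ , inj₂ (_ , e) | _ , _ , inj₂ (_ , e′) = contradiction (trans e (sym e′)) x′≢x″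
    ... | _ , _ , inj₁ (e , e′) | _ , _ , inj₂ (f , _) = contradiction (trans f (sym e′)) x≢x′
    ... | _ , _ , inj₂ (e , e′) | _ , _ , inj₁ (f , _) = contradiction (trans f (sym e′)) x≢x′

  -- Triples inside one pair of groups.

  once-bip : ∀ h i {a a′} b p q → a ≢ a′ →
             Once Blocks (pt h i (a , p)) (pt h i (a′ , p)) (pt h (not i) (b , q))
  once-bip h i {a} {a′} b p q a≢a′ with bbd-once bbd i b a≢a′
  ... | b₀ , b₀∈ , con , uniq = _ , bip h p₀ q₀ b₀∈ , relocate i con , same
    where
    -- `bipPt` expects the half of group `false` first, whereas `p` is the half used in group `i`.
    p₀ = pick i p q
    q₀ = pick i q p
    relocate : ∀ i → Contains b₀ (onSide i a) (onSide i a′) (onSide (not i) b) →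
               Contains (map (bipPt h (pick i p q) (pick i q p)) b₀)
                        (pt h i (a , p)) (pt h i (a′ , p)) (pt h (not i) (b , q))
    relocate false = contains-map (bipPt h p q)
    relocate true  = contains-map (bipPt h q p)
    parities : ∀ i {p′ q′} → p ≡ pick i p′ q′ → q ≡ pick (not i) p′ q′ →
               p′ ≡ pick i p q × q′ ≡ pick i q p
    parities false refl refl = refl , refl
    parities true  refl refl = refl , refl
    same : ∀ {c} → Blocks c → Contains c (pt h i (a , p)) (pt h i (a′ , p)) (pt h (not i) (b , q)) →
           SameElems (map (bipPt h p₀ q₀) b₀) c
    same (fill h′ i′ _) (x∈ , _ , y∈)
      with refl , refl ← pt∈fill h′ i′ x∈ = contradiction (sym (proj₂ (pt∈fill h′ i′ y∈))) h≢¬h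
    same (bip h′ p′ q′ b∈) (x∈ , x′∈ , y∈)
      with refl , p≡ , a∈ ← pt∈bip h′ p′ q′ x∈ | _ , _ , a′∈ ← pt∈bip h′ p′ q′ x′∈
         | _ , q≡ , b′∈ ← pt∈bip h′ p′ q′ y∈
      with refl , refl ← parities i p≡ q≡ = same-map (bipPt h p₀ q₀) (uniq b∈ (a∈ , a′∈ , b′∈))
    same (mix _ _ _ _ _ _) (x∈ , x′∈ , _) =
      contradiction (trans (proj₂ (pt∈mix x∈)) (sym (proj₂ (pt∈mix x′∈)))) a≢a′
    same (spoke _ _ _ _) (x∈ , x′∈ , _) =
      contradiction (cong proj₁ (spoke-injective x∈ x′∈)) a≢a′
    same (cross _ _ _ _ _ _ _ _) (x∈ , x′∈ , y∈)
      with refl , refl , _ ← cross-pair (a≢a′ ∘ cong proj₁) x∈ x′∈ | pt∈cross y∈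
    ... | inj₁ (e , _)     = contradiction (sym e) h≢¬h
    ... | inj₂ (_ , e , _) = contradiction (sym e) h≢¬h

  -- A copy of `B` uses a single half of each group, so two points from different halves of a group
  -- leave only a `mix` block. Its fourth point lies in the half `not r` of the other group and is
  -- found by division from `a · a′ ≡ b · b′`.
  once-mix : ∀ h i a a′ b r →
             Once Blocks (pt h i (a , false)) (pt h i (a′ , true)) (pt h (not i) (b , r))
  once-mix h i a a′ b r = blk i r , blk∈ i r , con i r , same
    where
    s = a · a′
    -- `i` decides on which side of the equation the known product `s` stands, and `r` which factor
    -- of the other product is `b`; the missing factor is always `b ╲ s`.
    blk : Bool → Bool → Block P
    blk false false = mixBlock h a a′ b (b ╲ s)
    blk false true  = mixBlock h a a′ (b ╲ s) b
    blk true  false = mixBlock h b (b ╲ s) a a′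
    blk true  true  = mixBlock h (b ╲ s) b a a′
    divides′ : (b ╲ s) · b ≡ s
    divides′ = trans (·-comm _ _) (·-divides b s)
    blk∈ : ∀ i r → Blocks (blk i r)
    blk∈ false false = mix h _ _ _ _ (sym (·-divides b s))
    blk∈ false true  = mix h _ _ _ _ (sym divides′)
    blk∈ true  false = mix h _ _ _ _ (·-divides b s)
    blk∈ true  true  = mix h _ _ _ _ divides′
    con : ∀ i r → Contains (blk i r) (pt h i (a , false)) (pt h i (a′ , true)) (pt h (not i) (b , r))
    con false false = here refl , there (here refl) , there (there (here refl))
    con false true  = here refl , there (here refl) , there (there (there (here refl)))
    con true  false = there (there (here refl)) , there (there (there (here refl))) , here refl
    con true  true  = there (there (here refl)) , there (there (there (here refl))) , there (here refl)
    unique-mix : ∀ i r {a₀ a₀′ b₀ b₀′} → a₀ · a₀′ ≡ b₀ · b₀′ →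
                 a ≡ pick i a₀ b₀ → a′ ≡ pick i a₀′ b₀′ →
                 b ≡ pick (not i) (pick r a₀ a₀′) (pick r b₀ b₀′) →
                 SameElems (blk i r) (mixBlock h a₀ a₀′ b₀ b₀′)
    unique-mix false false eq refl refl refl = same-reflexive
      (cong (mixBlock h a a′ b) (·-cancelˡ b (trans (·-divides b s) eq)))
    unique-mix false true eq refl refl refl = same-reflexive
      (cong (λ c → mixBlock h a a′ c b) (·-cancelʳ b (trans divides′ eq)))
    unique-mix true false eq refl refl refl = same-reflexive
      (cong (λ c → mixBlock h b c a a′) (·-cancelˡ b (trans (·-divides b s) (sym eq))))
    unique-mix true true eq refl refl refl = same-reflexive
      (cong (λ c → mixBlock h c b a a′) (·-cancelʳ b (trans divides′ (sym eq))))
    same : ∀ {c} → Blocks c → Contains c (pt h i (a , false)) (pt h i (a′ , true)) (pt h (not i) (b , r)) →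
           SameElems (blk i r) c
    same (fill h′ i′ _) (x∈ , _ , y∈)
      with refl , refl ← pt∈fill h′ i′ x∈ = contradiction (sym (proj₂ (pt∈fill h′ i′ y∈))) h≢¬h
    same (bip h′ p′ q′ _) (x∈ , x′∈ , _)
      with _ , p≡ , _ ← pt∈bip h′ p′ q′ x∈ | _ , p≡′ , _ ← pt∈bip h′ p′ q′ x′∈ =
      contradiction (trans p≡ (sym p≡′)) λ ()
    same (mix _ _ _ _ _ eq) (x∈ , x′∈ , y∈)
      with refl , a≡ ← pt∈mix x∈ = unique-mix i r eq a≡ (proj₂ (pt∈mix x′∈)) (proj₂ (pt∈mix y∈))
    same (spoke _ _ _ _) (x∈ , x′∈ , _) =
      contradiction (cong proj₂ (spoke-injective x∈ x′∈)) λ ()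
    same (cross _ _ _ _ _ _ _ _) (x∈ , x′∈ , y∈)
      with refl , refl , _ ← cross-pair (λ ()) x∈ x′∈ | pt∈cross y∈
    ... | inj₁ (e , _)     = contradiction (sym e) h≢¬h
    ... | inj₂ (_ , e , _) = contradiction (sym e) h≢¬h

  -- Triples joining a stem point to two different groups.

  once-∞-base : ∀ l h y z → Once Blocks (∞ l) (pt h false y) (pt h true z)
  once-∞-base l h y z =
    _ , spoke h l y z , (here refl , there (here refl) , there (there (here refl))) , same
    where
    same : ∀ {c} → Blocks c → Contains c (∞ l) (pt h false y) (pt h true z) →
           SameElems (spokeBlock h l y z) c
    same (fill h′ i′ _) (_ , y∈ , z∈) =
      contradiction (trans (proj₂ (pt∈fill h′ i′ y∈)) (sym (proj₂ (pt∈fill h′ i′ z∈)))) λ ()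
    same (bip h′ p q _) (l∈ , _)      = contradiction l∈ (∞∉bip h′ p q)
    same (mix _ _ _ _ _ _) (l∈ , _)   = contradiction l∈ ∞∉mix
    same (spoke _ _ _ _) (l∈ , y∈ , z∈)
      with refl ← ∞∈spoke l∈ | refl , refl , refl ← spoke-base y∈ z∈ = same-reflexive refl
    same (cross _ _ _ _ _ _ _ _) (l∈ , _) = contradiction l∈ ∞∉cross

  -- Division in `⊞` finds the second base point from the first and the value `t`; `i` tells which
  -- of the two is given.
  base-through : ∀ i y t → ∃[ y₀ ] ∃[ z₀ ] (y ≡ pick i y₀ z₀ × y₀ ⊞ z₀ ≡ t)
  base-through false y t = y , y ⊟ t , refl , ⊞-divides y t
  base-through true  z t = z ⊟ t , z , refl , trans (⊞-comm _ z) (⊞-divides z t)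

  base-determined : ∀ i {y₀ z₀ y₁ z₁} → pick i y₀ z₀ ≡ pick i y₁ z₁ → y₀ ⊞ z₀ ≡ y₁ ⊞ z₁ → y₀ ≡ y₁ × z₀ ≡ z₁
  base-determined false {y} refl eq = refl , ⊞-cancelˡ y eq
  base-determined true  {z₀ = z} refl eq = ⊞-cancelʳ z eq , refl

  -- The parity condition under which the block of ∞ l, pt h i y and pt (not h) j x
  -- has its base in the h-th pair of groups.
  Based : (l h i : Bool) → G → (j : Bool) → G → Set
  Based l h i (_ , p) j (_ , r) = r ≡ ((l xor h) xor p) xor (i ∧ j)

  -- Over the field with two elements the condition reads `r = l + h + p + ij`. Exchanging the two
  -- points swaps `p` with `r` and `i` with `j` and replaces `h` by `h + 1`, which turns the
  -- equation into its negation. This gives both the alternative here and its exclusiveness in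
  -- `based-exclusive`.
  based? : ∀ l h i y j x → Based l h i y j x ⊎ Based l (not h) j x i y
  based? l h i (_ , p) j (_ , r) with r ≟ᵇ ((l xor h) xor p) xor (i ∧ j)
  ... | yes r≡ = inj₁ r≡
  ... | no r≢ with refl ← ¬-not r≢ = inj₂ (parity l h i p j)
    where
    parity : ∀ l h i p j →
             p ≡ ((l xor not h) xor not (((l xor h) xor p) xor (i ∧ j))) xor (j ∧ i)
    parity = truth-table

  based-exclusive : ∀ l h i {y} j {x} → Based l h i y j x → ¬ Based l (not h) j x i y
  based-exclusive l h i {_ , p} j refl eq = h≢¬h (trans eq (parity l h i p j))
    where
    parity : ∀ l h i p j →
             ((l xor not h) xor (((l xor h) xor p) xor (i ∧ j))) xor (j ∧ i) ≡ not p
    parity = truth-table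

  -- The bit of the apex is defined from that of `y`. Seen from `z`, adding the branch, which is the
  -- sum of the bits of `y` and `z`, replaces the bit of `z` by that of `y`. This is the origin of
  -- the term `i ∧ j` in `Based`.
  apex-based : ∀ l h i y z → ((l xor h) xor proj₂ (pick i y z)) xor (i ∧ branch y z) ≡ proj₂ (apex h l y z)
  apex-based l h false (_ , p) _       = xor-identityʳ ((l xor h) xor p)
  apex-based l h true  (_ , p) (_ , q) = parity (l xor h) p q
    where
    parity : ∀ m p q → (m xor q) xor (p xor q) ≡ m xor p
    parity = truth-table

  base∈spoke : ∀ h l i y z → pt h i (pick i y z) ∈ spokeBlock h l y z
  base∈spoke h l false y z = there (here refl)
  base∈spoke h l true  y z = there (there (here refl))

  base∈cross : ∀ h ε i y z u u′ → pt h i (pick i y z) ∈ crossBlock h ε y z u u′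
  base∈cross h ε false y z u u′ = here refl
  base∈cross h ε true  y z u u′ = there (here refl)

  once-∞-across : ∀ l h {k} i y j x → k ≡ not h → Based l h i y j x →
                  Once Blocks (∞ l) (pt h i y) (pt k j x)
  -- A spoke block with apex `x` in group `j` needs a base whose `⊞`-value has first coordinate
  -- `proj₁ x` and bit `j`; `based` then makes the remaining bit of `x` that of the apex.
  once-∞-across l h i y j x refl based with base-through i y (proj₁ x , j)
  ... | y₀ , z₀ , refl , refl with refl ← trans based (apex-based l h i y₀ z₀) =
    _ , spoke h l y₀ z₀ , (here refl , base∈spoke h l i y₀ z₀ , there (there (there (here refl)))) , same
    where
    same : ∀ {c} → Blocks c → Contains c (∞ l) (pt h i y) (pt (not h) j x) →
           SameElems (spokeBlock h l y₀ z₀) c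
    same (fill h′ i′ _) (_ , y∈ , x∈)
      with refl , _ ← pt∈fill h′ i′ y∈ = contradiction (sym (proj₁ (pt∈fill h′ i′ x∈))) h≢¬h
    same (bip h′ p q _) (l∈ , _)      = contradiction l∈ (∞∉bip h′ p q)
    same (mix _ _ _ _ _ _) (l∈ , _)   = contradiction l∈ ∞∉mix
    same (spoke h′ _ y₁ z₁) (l∈ , y∈ , x∈) with ∞∈spoke l∈ | pt∈spoke y∈ | pt∈spoke x∈
    ... | refl | inj₁ (refl , y≡) | inj₂ (_ , j≡ , x≡) =
      same-reflexive (cong₂ (spokeBlock h l) (proj₁ yz) (proj₂ yz))
      where yz = base-determined i {y₀} {z₀} {y₁} {z₁} y≡ (cong₂ _,_ (cong proj₁ x≡) j≡)
    ... | refl | inj₁ (refl , _) | inj₁ (e , _) = contradiction (sym e) h≢¬h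
    ... | refl | inj₂ (refl , _) | inj₂ (e , _) = contradiction (sym e) h≢¬h
    -- Here `y` would be the apex over a base containing `x`, which yields the opposite parity
    -- condition.
    ... | refl | inj₂ (refl , i≡ , y≡) | inj₁ (_ , x≡) = ⊥-elim
      (based-exclusive l h′ j {x} i {y}
        (subst₂ (λ g b → proj₂ g ≡ ((l xor h′) xor proj₂ x) xor (j ∧ b)) (sym y≡) (sym i≡)
          (trans (sym (apex-based l h′ j y₁ z₁))
                 (cong (λ g → ((l xor h′) xor proj₂ g) xor (j ∧ branch y₁ z₁)) (sym x≡))))
        based)
    same (cross _ _ _ _ _ _ _ _) (l∈ , _) = contradiction l∈ ∞∉cross

  -- Triples of points from both pairs of groups.

  shift-involutive : ∀ ε t → shift ε (shift ε t) ≡ t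
  shift-involutive ε (c , p) = cong (c ,_) (parity ε p)
    where
    parity : ∀ ε p → (p xor ε) xor ε ≡ p
    parity = truth-table

  -- The value `x ⊙ x′` must be the key. Undoing the shift yields the `⊞`-value of the base, and `y`
  -- then determines the other base point. Commutativity of `⊙` takes care of the order of `x` and
  -- `x′`.
  once-pair-across : ∀ h {k} ε {x x′} i y → k ≡ not h → x ≢ x′ →
                     Once Blocks (pt k ε x) (pt k ε x′) (pt h i y)
  once-pair-across h ε {x} {x′} i y refl x≢x′ with base-through i y (shift ε (x ⊙ x′))
  ... | y₀ , z₀ , refl , eq =
    _ , cross h ε y₀ z₀ x x′ x≢x′ (trans (sym (shift-involutive ε (x ⊙ x′))) (cong (shift ε) (sym eq)))
      , (there (there (here refl)) , there (there (there (here refl))) , base∈cross h ε i y₀ z₀ x x′) , same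
    where
    base : ∀ {y₁ z₁ u u′} → (x ≡ u × x′ ≡ u′) ⊎ (x ≡ u′ × x′ ≡ u) → u ⊙ u′ ≡ key ε y₁ z₁ →
           y₀ ⊞ z₀ ≡ y₁ ⊞ z₁
    base {y₁} {z₁} (inj₁ (refl , refl)) eq₁ =
      trans eq (trans (cong (shift ε) eq₁) (shift-involutive ε (y₁ ⊞ z₁)))
    base {y₁} {z₁} (inj₂ (refl , refl)) eq₁ =
      trans eq (trans (cong (shift ε) (trans (⊙-comm x x′) eq₁)) (shift-involutive ε (y₁ ⊞ z₁)))
    same : ∀ {c} → Blocks c → Contains c (pt (not h) ε x) (pt (not h) ε x′) (pt h i y) →
           SameElems (crossBlock h ε y₀ z₀ x x′) c
    same (fill h′ i′ _) (x∈ , _ , y∈)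
      with refl , _ ← pt∈fill h′ i′ y∈ = contradiction (sym (proj₁ (pt∈fill h′ i′ x∈))) h≢¬h
    same (bip h′ p q _) (x∈ , _ , y∈)
      with refl , _ ← pt∈bip h′ p q y∈ = contradiction (sym (proj₁ (pt∈bip h′ p q x∈))) h≢¬h
    same (mix _ _ _ _ _ _) (x∈ , _ , y∈)
      with refl , _ ← pt∈mix y∈ = contradiction (sym (proj₁ (pt∈mix x∈))) h≢¬h
    same (spoke _ _ _ _) (x∈ , x′∈ , _) = contradiction (spoke-injective x∈ x′∈) x≢x′
    same (cross h′ _ y₁ z₁ u u′ _ eq₁) (x∈ , x′∈ , y∈) with cross-pair x≢x′ x∈ x′∈ | pt∈cross y∈
    ... | ¬h≡ , _ , _ | inj₂ (refl , _) = contradiction (sym ¬h≡) h≢¬h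
    ... | _ , refl , pair | inj₁ (refl , y≡)
      with refl , refl ← base-determined i {y₀} {z₀} {y₁} {z₁} y≡ (base {y₁} {z₁} pair eq₁) = oriented pair
      where
      oriented : (x ≡ u × x′ ≡ u′) ⊎ (x ≡ u′ × x′ ≡ u) →
                 SameElems (crossBlock h ε y₀ z₀ x x′) (crossBlock h ε y₀ z₀ u u′)
      oriented (inj₁ (refl , refl)) = same-reflexive refl
      oriented (inj₂ (refl , refl)) = same-swap

  transversal-blocks : ∀ {h ε y z x c} → Blocks c →
    Contains c (pt h false y) (pt h true z) (pt (not h) ε x) →
    (∃[ l ] (c ≡ spokeBlock h l y z × ε ≡ branch y z × x ≡ apex h l y z))
    ⊎ (∃[ x′ ] (x ≢ x′ × x ⊙ x′ ≡ key ε y z × SameElems (crossBlock h ε y z x x′) c))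
  transversal-blocks (fill h′ i′ _) (y∈ , z∈ , _) =
    contradiction (trans (proj₂ (pt∈fill h′ i′ y∈)) (sym (proj₂ (pt∈fill h′ i′ z∈)))) λ ()
  transversal-blocks (bip h′ p q _) (y∈ , _ , x∈)
    with refl , _ ← pt∈bip h′ p q y∈ = contradiction (sym (proj₁ (pt∈bip h′ p q x∈))) h≢¬h
  transversal-blocks (mix _ _ _ _ _ _) (y∈ , _ , x∈)
    with refl , _ ← pt∈mix y∈ = contradiction (sym (proj₁ (pt∈mix x∈))) h≢¬h
  transversal-blocks (spoke _ l _ _) (y∈ , z∈ , x∈) with spoke-base y∈ z∈ | pt∈spoke x∈
  ... | refl , refl , refl | inj₁ (e , _)        = contradiction (sym e) h≢¬h
  ... | refl , refl , refl | inj₂ (_ , ε≡ , x≡) = inj₁ (l , refl , ε≡ , x≡)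
  transversal-blocks (cross _ _ _ _ u u′ u≢u′ eq) (y∈ , z∈ , x∈) with cross-base y∈ z∈ | pt∈cross x∈
  ... | refl , refl , refl | inj₁ (e , _)                  = contradiction (sym e) h≢¬h
  ... | refl , refl , refl | inj₂ (_ , refl , inj₁ refl) = inj₂ (u′ , u≢u′ , eq , same-reflexive refl)
  ... | refl , refl , refl | inj₂ (_ , refl , inj₂ refl) =
    inj₂ (u , u≢u′ ∘ sym , trans (⊙-comm u′ u) eq , same-swap)

  -- The solution of `x ⊙ x′ ≡ key ε y z` is unique. If it is `x` itself, no cross block exists and
  -- the spoke block serves; otherwise the solution is a genuine partner, and `x` is not the apex of
  -- a spoke block.
  once-transversal : ∀ h {k} ε y z x → k ≡ not h →
                     Once Blocks (pt h false y) (pt h true z) (pt k ε x)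
  once-transversal h ε y z x@(c , r) refl with (x ⊙ x) ≟ᴳ key ε y z
  ... | yes diagonal = _ , spoke h l y z ,
    (there (here refl) , there (there (here refl)) , there (there (there (here x≡)))) , same
    where
    -- The stem point obtained by equating the bit of `apex h l y z` with `r`.
    l = (r xor h) xor proj₂ y
    -- Diagonal values have the bit `false`, which forces `ε` to be the branch.
    t≡ : (c , false) ≡ key ε y z
    t≡ = trans (sym (H-diagonal c r)) diagonal
    parity : ∀ r h p → (((r xor h) xor p) xor h) xor p ≡ r
    parity = truth-table
    xor-false : ∀ p q → false ≡ p xor q → q ≡ p
    xor-false false false _ = refl
    xor-false true  true  _ = refl
    x≡ : pt (not h) ε x ≡ (P ∋ pt (not h) (branch y z) (apex h l y z))
    x≡ = cong₂ (pt (not h)) (xor-false (branch y z) ε (cong proj₂ t≡))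
                            (cong₂ _,_ (cong proj₁ t≡) (sym (parity r h (proj₂ y))))
    same : ∀ {c} → Blocks c → Contains c (pt h false y) (pt h true z) (pt (not h) ε x) →
           SameElems (spokeBlock h l y z) c
    same c∈ con with transversal-blocks c∈ con
    ... | inj₁ (m , refl , _ , x≡) = same-reflexive (cong (λ l → spokeBlock h l y z)
      (trans (cong (λ r → (r xor h) xor proj₂ y) (cong proj₂ x≡)) (parity m h (proj₂ y))))
    ... | inj₂ (_ , x≢x′ , eq , _) = contradiction (⊙-cancelˡ x (trans diagonal (sym eq))) x≢x′
  ... | no x⊙x≢ = _ , cross h ε y z x x′ x≢x′ (⊙-divides x _)
      , (here refl , there (here refl) , there (there (here refl))) , same
    where
    x′ = x ⊘ key ε y z
    x≢x′ : x ≢ x′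
    x≢x′ e = x⊙x≢ (trans (cong (x ⊙_) e) (⊙-divides x _))
    same : ∀ {c} → Blocks c → Contains c (pt h false y) (pt h true z) (pt (not h) ε x) →
           SameElems (crossBlock h ε y z x x′) c
    same c∈ con with transversal-blocks c∈ con
    -- An apex is a square root of the key, against `x⊙x≢`.
    ... | inj₁ (_ , _ , ε≡ , x≡) = contradiction
      (trans (H-diagonal c r) (cong₂ _,_ (cong proj₁ x≡)
        (trans (sym (xor-same (branch y z))) (cong (branch y z xor_) (sym ε≡))))) x⊙x≢
    ... | inj₂ (x″ , _ , eq , same) = subst (λ w → SameElems (crossBlock h ε y z x w) _)
      (⊙-cancelˡ x (trans eq (sym (⊙-divides x _)))) same

  -- Case distinction over all triples.

  once-bipartite : ∀ h i {x x′} y → x ≢ x′ → Once Blocks (pt h i x) (pt h i x′) (pt h (not i) y)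
  once-bipartite h i {a , p} {a′ , p′} (b , q) x≢x′ with p | p′
  ... | false | false = once-bip h i b false q (x≢x′ ∘ cong (_, false))
  ... | true  | true  = once-bip h i b true q (x≢x′ ∘ cong (_, true))
  ... | false | true  = once-mix h i a a′ b q
  ... | true  | false = once-swap₁₂ (once-mix h i a′ a b q)

  pairwise-equal : (p q r : Bool) → p ≡ q ⊎ p ≡ r ⊎ q ≡ r
  pairwise-equal false false _     = inj₁ refl
  pairwise-equal true  true  _     = inj₁ refl
  pairwise-equal false true  false = inj₂ (inj₁ refl)
  pairwise-equal true  false true  = inj₂ (inj₁ refl)
  pairwise-equal false true  true  = inj₂ (inj₂ refl)
  pairwise-equal true  false false = inj₂ (inj₂ refl)

  distinct-swap₂₃ : {x y z : P} → Distinct3 x y z → Distinct3 x z y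
  distinct-swap₂₃ (x≢y , x≢z , y≢z) = x≢z , x≢y , y≢z ∘ sym

  distinct-rotate : {x y z : P} → Distinct3 x y z → Distinct3 y z x
  distinct-rotate (x≢y , x≢z , y≢z) = y≢z , x≢y ∘ sym , x≢z ∘ sym

  once-rotate : {x y z : P} → Once Blocks y z x → Once Blocks x y z
  once-rotate = once-swap₁₂ ∘ once-swap₂₃

  once-same-pair : ∀ h i j k {x y z} → Distinct3 {P} (pt h i x) (pt h i y) (pt k j z) →
                   Once Blocks (pt h i x) (pt h i y) (pt k j z)
  once-same-pair h i j k {z = z} (x≢y , x≢z , y≢z) with k ≟ᵇ h | j ≟ᵇ i
  ... | yes refl | yes refl =
    once-within h i (x≢y ∘ cong (pt h i) , x≢z ∘ cong (pt h i) , y≢z ∘ cong (pt h i))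
  ... | yes refl | no j≢i with refl ← ¬-not j≢i = once-bipartite h i z (x≢y ∘ cong (pt h i))
  ... | no k≢h | _ = once-pair-across k i j z (¬-not (k≢h ∘ sym)) (x≢y ∘ cong (pt h i))

  -- `blocks-once` arranges by pigeonhole that the first two points share a pair. Either two of the
  -- three points share a group, or the first two form a base with the third in the other pair.
  once-pts : ∀ h i j k m {x y z} → Distinct3 {P} (pt h i x) (pt h j y) (pt k m z) →
             Once Blocks (pt h i x) (pt h j y) (pt k m z)
  once-pts h i j k m {x} {y} {z} distinct with i ≟ᵇ j
  ... | yes refl = once-same-pair h i m k distinct
  ... | no i≢j with k ≟ᵇ h
  once-pts h i j k m distinct | no i≢j | yes refl with pairwise-equal i j m
  ... | inj₁ i≡j         = ⊥-elim (i≢j i≡j)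
  ... | inj₂ (inj₁ refl) = once-swap₂₃ (once-same-pair h i j h (distinct-swap₂₃ distinct))
  ... | inj₂ (inj₂ refl) = once-rotate (once-same-pair h j i h (distinct-rotate distinct))
  once-pts h false true  k m {x} {y} {z} _ | no _ | no k≢h = once-transversal h m x y z (¬-not k≢h)
  once-pts h true  false k m {x} {y} {z} _ | no _ | no k≢h =
    once-swap₁₂ (once-transversal h m y x z (¬-not k≢h))
  once-pts h false false k m _ | no i≢j | no _ = ⊥-elim (i≢j refl)
  once-pts h true  true  k m _ | no i≢j | no _ = ⊥-elim (i≢j refl)

  once-∞ : ∀ l h i k j {x y} → Distinct3 {P} (∞ l) (pt h i x) (pt k j y) →
           Once Blocks (∞ l) (pt h i x) (pt k j y)
  once-∞ l h i k j {x} {y} (_ , _ , x≢y) with k ≟ᵇ h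
  once-∞ l h i k j {x} {y} (_ , _ , x≢y) | no k≢h with based? l h i x j y
  ... | inj₁ based = once-∞-across l h i x j y (¬-not k≢h) based
  -- The base belongs to the pair of the last point, so the two points change roles.
  ... | inj₂ based with refl ← ¬-not k≢h =
    once-swap₂₃ (once-∞-across l (not h) j y i x (sym (not-involutive h)) based)
  once-∞ l h i     k j     {x} {y} (_ , _ , x≢y) | yes refl with i ≟ᵇ j
  once-∞ l h i     k j     {x} {y} (_ , _ , x≢y) | yes refl | yes refl =
    once-∞-within l h i (x≢y ∘ cong (pt h i))
  once-∞ l h false k true  {x} {y} _ | yes refl | no _ = once-∞-base l h x y
  once-∞ l h true  k false {x} {y} _ | yes refl | no _ = once-swap₂₃ (once-∞-base l h y x)
  once-∞ l h false k false _ | yes refl | no i≢j = ⊥-elim (i≢j refl)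
  once-∞ l h true  k true  _ | yes refl | no i≢j = ⊥-elim (i≢j refl)

  blocks-once : ∀ x y z → Distinct3 x y z → Once Blocks x y z
  blocks-once (∞ l) (∞ l′) (∞ l″) (d , d′ , d″) with pairwise-equal l l′ l″
  ... | inj₁ refl        = contradiction refl d
  ... | inj₂ (inj₁ refl) = contradiction refl d′
  ... | inj₂ (inj₂ refl) = contradiction refl d″
  blocks-once (∞ l) (∞ l′) (pt h i z) (d , _) = once-∞∞ h i z (d ∘ cong inj₁)
  blocks-once (∞ l) (pt h i y) (∞ l′) (_ , d , _) = once-swap₂₃ (once-∞∞ h i y (d ∘ cong inj₁))
  blocks-once (pt h i x) (∞ l) (∞ l′) (_ , _ , d) = once-rotate (once-∞∞ h i x (d ∘ cong inj₁))
  blocks-once (∞ l) (pt h i y) (pt k j z) d = once-∞ l h i k j d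
  blocks-once (pt h i x) (∞ l) (pt k j z) d =
    once-rotate (once-swap₂₃ (once-∞ l h i k j (distinct-swap₂₃ (distinct-rotate d))))
  blocks-once (pt h i x) (pt k j y) (∞ l) d =
    once-rotate (once-rotate (once-∞ l h i k j (distinct-rotate (distinct-rotate d))))
  blocks-once (pt h i x) (pt k j y) (pt m o z) d with pairwise-equal h k m
  ... | inj₁ refl        = once-pts h i j m o d
  ... | inj₂ (inj₁ refl) = once-swap₂₃ (once-pts h i o k j (distinct-swap₂₃ d))
  ... | inj₂ (inj₂ refl) = once-rotate (once-pts k j o h i (distinct-rotate d))

  -- The list of all blocks.

  fills : List (Block P)
  fills = map (λ ((h , i) , b) → map (fillPt h i) b) (cartesianProduct elements S)

  bips : List (Block P)
  bips = map (λ ((h , p , q) , b) → map (bipPt h p q) b) (cartesianProduct elements B)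

  IsMix : Bool × Fin n × Fin n × Fin n × Fin n → Set
  IsMix (_ , a , a′ , b , b′) = a · a′ ≡ b · b′

  isMix? : ∀ t → Dec (IsMix t)
  isMix? (_ , a , a′ , b , b′) = (a · a′) Fin.≟ (b · b′)

  toMix : Bool × Fin n × Fin n × Fin n × Fin n → Block P
  toMix (h , a , a′ , b , b′) = mixBlock h a a′ b b′

  mixes : List (Block P)
  mixes = map toMix (filter isMix? elements)

  spokes : List (Block P)
  spokes = map (λ (h , l , y , z) → spokeBlock h l y z) elements

  IsCross : Bool × Bool × G × G × G × G → Set
  IsCross (_ , ε , y , z , u , u′) = u ≢ u′ × u ⊙ u′ ≡ key ε y z

  isCross? : ∀ t → Dec (IsCross t)
  isCross? (_ , ε , y , z , u , u′) = ¬? (u ≟ᴳ u′) ×-dec ((u ⊙ u′) ≟ᴳ key ε y z)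

  toCross : Bool × Bool × G × G × G × G → Block P
  toCross (h , ε , y , z , u , u′) = crossBlock h ε y z u u′

  crosses : List (Block P)
  crosses = map toCross (filter isCross? elements)

  -- Repetitions do occur: a cross block is listed for both orders of `u` and `u′`.
  blockList : List (Block P)
  blockList = fills ++ bips ++ mixes ++ spokes ++ crosses

  blockList-sound : ∀ {b} → b ∈ blockList → Blocks b
  blockList-sound b∈ with ∈-++⁻ fills b∈
  ... | inj₁ b∈ with ((h , i) , _) , t∈ , refl ← ∈-map⁻ _ b∈ =
    fill h i (proj₂ (∈-cartesianProduct⁻ elements S t∈))
  ... | inj₂ b∈ with ∈-++⁻ bips b∈
  ... | inj₁ b∈ with ((h , p , q) , _) , t∈ , refl ← ∈-map⁻ _ b∈ =
    bip h p q (proj₂ (∈-cartesianProduct⁻ elements B t∈))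
  ... | inj₂ b∈ with ∈-++⁻ mixes b∈
  ... | inj₁ b∈
    with (h , a , a′ , b , b′) , _ , refl , eq ← ∈-map∘filter⁻ toMix isMix? {xs = elements} b∈ =
    mix h a a′ b b′ eq
  ... | inj₂ b∈ with ∈-++⁻ spokes b∈
  ... | inj₁ b∈ with (h , l , y , z) , _ , refl ← ∈-map⁻ _ b∈ = spoke h l y z
  ... | inj₂ b∈
    with (h , ε , y , z , u , u′) , _ , refl , u≢u′ , eq ←
      ∈-map∘filter⁻ toCross isCross? {xs = elements} b∈ =
    cross h ε y z u u′ u≢u′ eq

  blockList-complete : ∀ {b} → Blocks b → b ∈ blockList
  blockList-complete (fill h i b∈) =
    ∈-++⁺ˡ (∈-map⁺ _ (∈-cartesianProduct⁺ (complete (h , i)) b∈))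
  blockList-complete (bip h p q b∈) =
    ∈-++⁺ʳ fills (∈-++⁺ˡ (∈-map⁺ _ (∈-cartesianProduct⁺ (complete (h , p , q)) b∈)))
  blockList-complete (mix h a a′ b b′ eq) =
    ∈-++⁺ʳ fills (∈-++⁺ʳ bips (∈-++⁺ˡ (∈-map∘filter⁺ toMix isMix?
      ((h , a , a′ , b , b′) , complete _ , refl , eq))))
  blockList-complete (spoke h l y z) =
    ∈-++⁺ʳ fills (∈-++⁺ʳ bips (∈-++⁺ʳ mixes (∈-++⁺ˡ (∈-map⁺ _ (complete (h , l , y , z))))))
  blockList-complete (cross h ε y z u u′ u≢u′ eq) =
    ∈-++⁺ʳ fills (∈-++⁺ʳ bips (∈-++⁺ʳ mixes (∈-++⁺ʳ spokes (∈-map∘filter⁺ toCross isCross?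
      ((h , ε , y , z , u , u′) , complete _ , refl , u≢u′ , eq)))))

  blockList-once : ∀ x y z → Distinct3 x y z → Once (_∈ blockList) x y z
  blockList-once x y z distinct with b , b∈ , con , uniq ← blocks-once x y z distinct =
    b , blockList-complete b∈ , con , uniq ∘ blockList-sound

-- Transfer to `Fin` and conclusion.

Design : (ℕ → Set) → (v : ℕ) → List (Block (Fin v)) → Set
Design W v D =
  All (λ b → W (length b) × Unique b) D
  × (∀ x y z → Distinct3 x y z → ExactlyOnce D x y z)

distinct-map : {f : A → C} → Injective _≡_ _≡_ f → ∀ {x y z} →
               Distinct3 x y z → Distinct3 (f x) (f y) (f z)
distinct-map inj (x≢y , x≢z , y≢z) = x≢y ∘ inj , x≢z ∘ inj , y≢z ∘ inj

stemmed↔ : ∀ n → Fin (2 * n + 2) ↔ Stemmed (Fin n × Bool)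
stemmed↔ n =
  (2↔Bool ⊎-↔ ((↔-id _ ×-↔ 2↔Bool) ↔-∘ *↔×)) ↔-∘ (+↔⊎ ↔-∘ cast↔ (size n))
  where
  size : ∀ n → 2 * n + 2 ≡ 2 + n * 2
  size = solve-∀

points↔ : ∀ n → Points (Fin n × Bool) ↔ Fin (8 * n + 2)
points↔ n = ↔-sym
  ((2↔Bool ⊎-↔ (2↔Bool ⊗ (2↔Bool ⊗ (↔-id _ ⊗ 2↔Bool)))) ↔-∘ (+↔⊎ ↔-∘ cast↔ (size n)))
  where
  _⊗_ : ∀ {k l} {A C : Set} → Fin k ↔ A → Fin l ↔ C → Fin (k * l) ↔ (A × C)
  f ⊗ g = (f ×-↔ g) ↔-∘ *↔×
  size : ∀ n → 8 * n + 2 ≡ 2 + 2 * (2 * (n * 2))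
  size = solve-∀

-- The blocks are moved to `Fin` before repetitions are removed, because `sameElems?` searches
-- through all points of a finite type.
extend : {W : ℕ → Set} → W 4 → ∀ {n} →
         (Q : CommutativeQuasigroup (Fin n)) (H : CommutativeQuasigroup (Fin n × Bool)) →
         (∀ a p → let open CommutativeQuasigroup H in (a , p) ∙ (a , p) ≡ (a , false)) →
         Fin (2 * n + 2) ↔ Stemmed (Fin n × Bool) → Points (Fin n × Bool) ↔ Fin (8 * n + 2) →
         ∀ S → Design W (2 * n + 2) S → ∀ B → BBD n B →
         ∃[ S′ ] (Design W (8 * n + 2) S′ × Embeds S S′ × Embeds B S′)
extend {W} W4 Q H H-diagonal σ τ S (S-shape , S-exact) B bbd =
  deduplicate sameElems? D ,
  (All.deduplicate⁺ sameElems? (All.map⁺ (All.tabulate λ b∈ →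
      shape-map {W = W} (↔-injective τ) (blocks-shape (blockList-sound b∈)))) ,
   λ x y z distinct → once⇒exactlyOnce D (once-image τ
      (blockList-once _ _ _ (distinct-map (↔-injective (↔-sym τ)) distinct)))) ,
  -- The copy of `S` on the stem and group `false` of pair `false`.
  (to τ ∘ fillPt false false ∘ to σ ,
   ↔-injective σ ∘ fillPt-injective false false ∘ ↔-injective τ ,
   All.tabulate λ {b} b∈ → embedded
     (trans (map-∘ b) (map-∘ (map (to σ) b)))
     (fill false false (∈-map⁺ (map (to σ)) b∈))) ,
  -- The copy of `B` on the halves `false` of both groups of pair `false`.
  (to τ ∘ bipPt false false false ,
   bipPt-injective false false false ∘ ↔-injective τ ,
   All.tabulate λ {b} b∈ → embedded (map-∘ b) (bip false false false b∈))
  where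
  open Inverse using (to; from)
  open Construction Q H H-diagonal W W4
    {S = map (map (to σ)) S}
    (All.map⁺ (All.map (shape-map {W = W} (↔-injective σ)) S-shape))
    (λ x y z distinct → once-image σ (exactlyOnce⇒once
      (S-exact _ _ _ (distinct-map (↔-injective (↔-sym σ)) distinct))))
    bbd
  D = map (map (to τ)) blockList
  embedded : ∀ {b c} → c ≡ map (to τ) b → Blocks b → Any (SameElems c) (deduplicate sameElems? D)
  embedded refl b∈ = deduplicate-keeps D (∈-map⁺ (map (to τ)) (blockList-complete b∈))

theorem3 : ∀ (n : ℕ) → 75 < n → 2 ∣ n →
    (∀ (S : List (Block (Fin (2 * n + 2)))) → SQS (2 * n + 2) S →
    ∀ (B : List (Block (Fin n ⊎ Fin n))) → BBD n B →
    ∃[ S' ] (SQS (8 * n + 2) S' × Embeds S S' × Embeds B S'))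
    ×
    (∀ (S : List (Block (Fin (2 * n + 2)))) → S346 (2 * n + 2) S →
    ∀ (B : List (Block (Fin n ⊎ Fin n))) → BBD n B →
    ∃[ S' ] (S346 (8 * n + 2) S' × Embeds S S' × Embeds B S'))
-- The form `suc _` supplies the instance `NonZero n` for reduction modulo `n` and `2 * n`. For the
-- two size predicates below, `Design` unfolds to `SQS` and to `S346`.
theorem3 n@(suc _) _ _ =
  extend′ {_≡ 4} refl , extend′ {λ k → k ≡ 4 ⊎ k ≡ 6} (inj₁ refl)
  where
  extend′ : {W : ℕ → Set} → W 4 → ∀ S → Design W (2 * n + 2) S → ∀ B → BBD n B →
            ∃[ S′ ] (Design W (8 * n + 2) S′ × Embeds S S′ × Embeds B S′)
  extend′ {W} W4 = extend {W} W4 (mod-+ n) (halving n) (halving-diagonal n) (stemmed↔ n) (points↔ n)
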